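{- $\limsup_{n\to\infty} \nu(n)=\infty$.
   Context: Let $F(x,y,z)=x^3+y^3+z^3-3xyz$. For a positive integer $n$, $\nu(n)$ denotes the number of triples of integers $(x,y,z)$ with $0\leq x\leq y\leq z$ and $z\geq x+1$ such that $F(x,y,z)=n$. -}

module Defs where

open import Data.Nat.Base as ℕ using (ℕ; suc)
import Data.Nat.Properties as ℕ
open import Data.Integer.Base
  using (ℤ; +_; 0ℤ; 1ℤ; _+_; _*_; _-_; _^_; _≤_; _≥_; +≤+)
open import Data.Integer.Properties as ℤ using (_≟_; _≤?_; pos-*; +-injective)
open import Data.Integer.Tactic.RingSolver using (solve-∀)
open import Data.List.Base using (List; length; map; upTo; filter; cartesianProduct)
open import Data.List.Membership.Propositional using (_∈_)
open import Data.List.Membership.Propositional.Properties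
  using (∈-map⁺; ∈-upTo⁺; ∈-cartesianProduct⁺; ∈-filter⁺; ∈-filter⁻)
open import Data.List.Relation.Unary.Unique.Propositional using (Unique)
import Data.List.Relation.Unary.Unique.Propositional.Properties as Unique
open import Data.Product.Base using (_×_; _,_; proj₂; ∃-syntax)
open import Function.Bundles using (_⇔_; mk⇔)
open import Relation.Binary.PropositionalEquality
  using (_≡_; refl; sym; trans; cong; cong₂; subst)
open import Relation.Nullary.Decidable using (_×-dec_)
open import Relation.Unary using (Decidable)

F : ℤ → ℤ → ℤ → ℤ
F x y z = x ^ 3 + y ^ 3 + z ^ 3 - + 3 * x * y * z

IsSolution : ℕ → ℤ × ℤ × ℤ → Set
IsSolution n (x , y , z) =
  (0ℤ ≤ x) × (x ≤ y) × (y ≤ z) × (z ≥ x + 1ℤ) × (F x y z ≡ + n)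

isSolution? : ∀ n → Decidable (IsSolution n)
isSolution? n (x , y , z) =
  (0ℤ ≤? x) ×-dec (x ≤? y) ×-dec (y ≤? z) ×-dec (x + 1ℤ ≤? z) ×-dec (F x y z ≟ + n)

private
  range : ℕ → List ℤ
  range n = map +_ (upTo (suc n))

  box : ℕ → List (ℤ × ℤ × ℤ)
  box n = cartesianProduct (range n) (cartesianProduct (range n) (range n))

-- Searching 0 ≤ x, y, z ≤ n loses no solution, by ∈-solutions below.
solutions : ℕ → List (ℤ × ℤ × ℤ)
solutions n = filter (isSolution? n) (box n)

-- Total on ℕ for convenience; only positive n matter in the limit.
ν : ℕ → ℕ
ν n = length (solutions n)

private
  F-factor : ∀ x a b → F x (x + a) (x + a + b)
           ≡ (x + a + b + (x + x + a)) * (a * a + a * b + b * b)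
  F-factor = unfolded
    where
    -- The ring solver does not see through F and _^_.
    unfolded : ∀ x a b →
      x * (x * (x * 1ℤ)) + (x + a) * ((x + a) * ((x + a) * 1ℤ))
        + (x + a + b) * ((x + a + b) * ((x + a + b) * 1ℤ))
        - + 3 * x * (x + a) * (x + a + b)
      ≡ (x + a + b + (x + x + a)) * (a * a + a * b + b * b)
    unfolded = solve-∀

  Q : ℕ → ℕ → ℕ
  Q a b = a ℕ.* a ℕ.+ a ℕ.* b ℕ.+ b ℕ.* b

  F-factorℕ : ∀ m a b → F (+ m) (+ (m ℕ.+ a)) (+ (m ℕ.+ a ℕ.+ b))
            ≡ + ((m ℕ.+ a ℕ.+ b ℕ.+ (m ℕ.+ m ℕ.+ a)) ℕ.* Q a b)
  F-factorℕ m a b = trans (F-factor (+ m) (+ a) (+ b))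
    (trans (cong (+ s *_) (cong₂ _+_ (cong₂ _+_ (sym (pos-* a a)) (sym (pos-* a b)))
                                     (sym (pos-* b b))))
           (sym (pos-* s (Q a b))))
    where s = m ℕ.+ a ℕ.+ b ℕ.+ (m ℕ.+ m ℕ.+ a)

  Q-positive : ∀ m a b → m ℕ.+ 1 ℕ.≤ m ℕ.+ a ℕ.+ b → 1 ℕ.≤ Q a b
  Q-positive m (suc a) b       _ = ℕ.s≤s ℕ.z≤n
  Q-positive m 0       (suc b) _ = ℕ.s≤s ℕ.z≤n
  Q-positive m 0       0       p
    with () ← ℕ.+-cancelˡ-≤ m 1 0
                (subst (m ℕ.+ 1 ℕ.≤_) (ℕ.+-identityʳ (m ℕ.+ 0)) p)

  z-bound : ∀ {n m k l} → m ℕ.≤ k → k ℕ.≤ l → m ℕ.+ 1 ℕ.≤ l →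
            F (+ m) (+ k) (+ l) ≡ + n → l ℕ.≤ n
  z-bound {n} {m} m≤k k≤l m<l eq
    with a , refl ← ℕ.m≤n⇒∃[o]m+o≡n m≤k
    with b , refl ← ℕ.m≤n⇒∃[o]m+o≡n k≤l = begin
      l             ≤⟨ ℕ.m≤m+n l (m ℕ.+ m ℕ.+ a) ⟩
      s             ≡⟨ ℕ.*-identityʳ s ⟨
      s ℕ.* 1       ≤⟨ ℕ.*-monoʳ-≤ s (Q-positive m a b m<l) ⟩
      s ℕ.* Q a b   ≡⟨ +-injective (trans (sym (F-factorℕ m a b)) eq) ⟩
      n             ∎
    where
    open ℕ.≤-Reasoning
    l = m ℕ.+ a ℕ.+ b
    s = l ℕ.+ (m ℕ.+ m ℕ.+ a)

  ∈-range : ∀ {n m} → m ℕ.≤ n → + m ∈ range n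
  ∈-range m≤n = ∈-map⁺ +_ (∈-upTo⁺ (ℕ.s≤s m≤n))

  solution∈box : ∀ {n t} → IsSolution n t → t ∈ box n
  solution∈box (+≤+ _ , +≤+ x≤y , +≤+ y≤z , +≤+ x<z , eq) =
    ∈-cartesianProduct⁺ (∈-range (ℕ.≤-trans x≤y y≤n))
      (∈-cartesianProduct⁺ (∈-range y≤n) (∈-range z≤n))
    where
    z≤n = z-bound x≤y y≤z x<z eq
    y≤n = ℕ.≤-trans y≤z z≤n

  range-unique : ∀ n → Unique (range n)
  range-unique n = Unique.map⁺ +-injective (Unique.upTo⁺ (suc n))

∈-solutions : ∀ n {t} → t ∈ solutions n ⇔ IsSolution n t
∈-solutions n = mk⇔
  (λ t∈ → proj₂ (∈-filter⁻ (isSolution? n) {xs = box n} t∈))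
  (λ sol → ∈-filter⁺ (isSolution? n) (solution∈box sol) sol)

solutions-unique : ∀ n → Unique (solutions n)
solutions-unique n = Unique.filter⁺ (isSolution? n)
  (Unique.cartesianProduct⁺ (range-unique n)
    (Unique.cartesianProduct⁺ (range-unique n) (range-unique n)))

-- sup { f n | n ≥ N } = ∞
TailSup=∞ : (ℕ → ℕ) → ℕ → Set
TailSup=∞ f N = ∀ M → ∃[ n ] N ℕ.≤ n × M ℕ.≤ f n

-- lim sup f = inf_N sup { f n | n ≥ N }, which is ∞ iff every tail supremum is.
LimSup=∞ : (ℕ → ℕ) → Set
LimSup=∞ f = ∀ N → TailSup=∞ f N

{-# OPTIONS --safe #-}
-- F is homogeneous of degree 3 and F(t, t, t + 1) = 3t + 1.  For each i ≤ m the number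
-- 64^(m − i) has the form 3t + 1, and scaling (t, t, t + 1) by 4^i gives a solution of
-- F = 64^m.  The differences z − x = 4^i tell these m + 1 solutions apart.
module Submission where

open import Defs
open import Data.Fin.Base using (Fin; toℕ)
open import Data.Fin.Properties using (injective⇒≤; toℕ-injective; toℕ≤pred[n])
open import Data.Integer.Base as ℤ using (ℤ; +_; 1ℤ; +≤+)
open import Data.Integer.Properties as ℤ using (pos-*; +-injective)
import Data.Integer.Tactic.RingSolver as ℤ-Solver
open import Data.List.Membership.Propositional using (_∈_)
open import Data.List.Membership.Setoid.Properties using (index-injective)
open import Data.List.Relation.Unary.Any using (index)
open import Data.Nat.Base
open import Data.Nat.Properties
open import Data.Nat.Tactic.RingSolver using (solve-∀)
open import Data.Product.Base using (_×_; _,_; proj₁; proj₂)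
open import Function.Bundles using (Equivalence)
open import Function.Definitions using (Injective)
open import Relation.Binary.Definitions using (tri<; tri≈; tri>)
open import Relation.Binary.PropositionalEquality
open import Relation.Nullary.Negation using (contradiction)

^-injectiveʳ : ∀ m → 1 < m → Injective _≡_ _≡_ (m ^_)
^-injectiveʳ m 1<m {i} {j} eq with <-cmp i j
... | tri< i<j _ _ = contradiction eq (<⇒≢ (^-monoʳ-< m 1<m i<j))
... | tri≈ _ i≡j _ = i≡j
... | tri> _ _ j<i = contradiction (sym eq) (<⇒≢ (^-monoʳ-< m 1<m j<i))

n≤m^n : ∀ m → 1 < m → ∀ n → n ≤ m ^ n
n≤m^n m 1<m zero    = z≤n
n≤m^n m 1<m (suc n) = ≤-<-trans (n≤m^n m 1<m n) (^-monoʳ-< m 1<m (n<1+n n))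

-- A position in `solutions n` holds a single triple, so sending `i` to the position of `f i` is an
-- injection from `Fin k` into `Fin (ν n)`.
injection⇒≤ν : ∀ {k n} {f : Fin k → ℤ × ℤ × ℤ} → Injective _≡_ _≡_ f →
               (∀ i → IsSolution n (f i)) → k ≤ ν n
injection⇒≤ν {n = n} {f} f-injective f-solution =
  injective⇒≤ λ {i} {j} eq → f-injective (index-injective (setoid _) (f∈ i) (f∈ j) eq)
  where
  f∈ : ∀ i → f i ∈ solutions n
  f∈ i = Equivalence.from (∈-solutions n) (f-solution i)

-- Case x = y of F = (x + y + z)((x - y)² + (y - z)² + (z - x)²)/2: the linear factor becomes 3k + d
-- and the quadratic one d².
F-two-equal : ∀ k d → F (+ k) (+ k) (+ (k + d)) ≡ + ((3 * k + d) * (d * d))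
F-two-equal k d = begin
  F (+ k) (+ k) (+ k ℤ.+ + d)                      ≡⟨ unfolded (+ k) (+ d) ⟩
  (+ 3 ℤ.* + k ℤ.+ + d) ℤ.* (+ d ℤ.* + d)          ≡⟨ cong₂ ℤ._*_ (cong (ℤ._+ + d) (sym (pos-* 3 k)))
                                                                 (sym (pos-* d d)) ⟩
  + (3 * k + d) ℤ.* + (d * d)                      ≡⟨ pos-* (3 * k + d) (d * d) ⟨
  + ((3 * k + d) * (d * d))                        ∎
  where
  open ≡-Reasoning
  unfolded : ∀ x d →
    x ℤ.* (x ℤ.* (x ℤ.* 1ℤ)) ℤ.+ x ℤ.* (x ℤ.* (x ℤ.* 1ℤ))
      ℤ.+ (x ℤ.+ d) ℤ.* ((x ℤ.+ d) ℤ.* ((x ℤ.+ d) ℤ.* 1ℤ))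
      ℤ.- + 3 ℤ.* x ℤ.* x ℤ.* (x ℤ.+ d)
    ≡ (+ 3 ℤ.* x ℤ.+ d) ℤ.* (d ℤ.* d)
  unfolded = ℤ-Solver.solve-∀

-- Recursion instead of division: 64(3t + 1) = 3(64t + 21) + 1, where 21 = (64 - 1)/3.
[64^_∸1]/3 : ℕ → ℕ
[64^ zero  ∸1]/3 = 0
[64^ suc j ∸1]/3 = 64 * [64^ j ∸1]/3 + 21

3*[64^j∸1]/3+1≡64^j : ∀ j → 3 * [64^ j ∸1]/3 + 1 ≡ 64 ^ j
3*[64^j∸1]/3+1≡64^j zero    = refl
3*[64^j∸1]/3+1≡64^j (suc j) = trans (step [64^ j ∸1]/3) (cong (64 *_) (3*[64^j∸1]/3+1≡64^j j))
  where
  step : ∀ t → 3 * (64 * t + 21) + 1 ≡ 64 * (3 * t + 1)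
  step = solve-∀

smallest : ℕ → ℕ → ℕ
smallest i j = 4 ^ i * [64^ j ∸1]/3

scaled : ℕ → ℕ → ℤ × ℤ × ℤ
scaled i j = + smallest i j , + smallest i j , + (smallest i j + 4 ^ i)

scaled-solution : ∀ i j → IsSolution (64 ^ (i + j)) (scaled i j)
scaled-solution i j =
  -- The condition z ≥ x + 1 amounts to 1 ≤ 4^i.
  +≤+ z≤n , ℤ.≤-refl , +≤+ (m≤m+n k d) , +≤+ (+-monoʳ-≤ k (m^n>0 4 i)) ,
  trans (F-two-equal k d) (cong +_ value)
  where
  open ≡-Reasoning
  t = [64^ j ∸1]/3
  d = 4 ^ i
  k = smallest i j

  -- The factor d taken out of 3k + d joins d² to form the cube, written as `d ^ 3` unfolds.
  homogeneous : ∀ d t → (3 * (d * t) + d) * (d * d) ≡ d * (d * (d * 1)) * (3 * t + 1)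
  homogeneous = solve-∀

  value : (3 * k + d) * (d * d) ≡ 64 ^ (i + j)
  value = begin
    (3 * k + d) * (d * d)    ≡⟨ homogeneous d t ⟩
    d ^ 3 * (3 * t + 1)      ≡⟨ cong₂ _*_ cube (3*[64^j∸1]/3+1≡64^j j) ⟩
    64 ^ i * 64 ^ j          ≡⟨ ^-distribˡ-+-* 64 i j ⟨
    64 ^ (i + j)             ∎
    where
    cube : d ^ 3 ≡ 64 ^ i
    cube = begin
      (4 ^ i) ^ 3   ≡⟨ ^-*-assoc 4 i 3 ⟩
      4 ^ (i * 3)   ≡⟨ cong (4 ^_) (*-comm i 3) ⟩
      4 ^ (3 * i)   ≡⟨ ^-*-assoc 4 3 i ⟨
      64 ^ i        ∎

scaled-injective : ∀ {i j i′ j′} → scaled i j ≡ scaled i′ j′ → i ≡ i′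
scaled-injective {i} {j} {i′} {j′} eq =
  -- Equal first entries can be cancelled from the last ones, leaving 4^i = 4^i′, whatever `j` and
  -- `j′` are.
  ^-injectiveʳ 4 (s≤s (s≤s z≤n)) (+-cancelˡ-≡ (smallest i j) _ _
    (trans (+-injective (cong (λ t → proj₂ (proj₂ t)) eq))
           (cong (_+ 4 ^ i′) (sym (+-injective (cong proj₁ eq))))))

m<ν[64^m] : ∀ m → m < ν (64 ^ m)
-- The strict bound asks for `suc m` triples, so `i` runs over 0, ..., m.
m<ν[64^m] m = injection⇒≤ν {f = λ i → scaled (toℕ i) (m ∸ toℕ i)}
  (λ {i} {i′} eq → toℕ-injective (scaled-injective {j = m ∸ toℕ i} {j′ = m ∸ toℕ i′} eq))
  (λ i → subst (λ e → IsSolution (64 ^ e) (scaled (toℕ i) (m ∸ toℕ i)))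
               -- As i ≤ m, the truncated subtraction is exact and the exponents add up to m.
               (m+[n∸m]≡n (toℕ≤pred[n] i))
               (scaled-solution (toℕ i) (m ∸ toℕ i)))

proposition5 : LimSup=∞ ν
proposition5 N M = 64 ^ m
  , ≤-trans (m≤m+n N M) (n≤m^n 64 (s≤s (s≤s z≤n)) m)
  , ≤-trans (m≤n+m M N) (<⇒≤ (m<ν[64^m] m))
  -- One exponent serves both bounds: N ≤ m ≤ 64^m and M ≤ m < ν(64^m).
  where m = N + M
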